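{- Let $k,d,\ell$ be integers with $1\le d\le k-1$ and $0\le \ell\le k-1$. If $d\ge \max\{k-\ell,\ \lfloor k/2\rfloor+1\}$, then $g(k,d,\ell)=0$.
   Context: A $k$-graph $H$ is a $k$-uniform hypergraph: a finite vertex set $V(H)$ with edge set $E(H)\subseteq\binom{V(H)}{k}$. For $1\le d\le k-1$, $\deg_H(S)$ is the number of edges containing a $d$-set $S\subseteq V(H)$, and $\delta_d(H)=\min\deg_H(S)$ over all $d$-subsets $S$ of $V(H)$. Construction: let $0\le \ell\le k-1$, $j\in\{0,1,\dots,\ell+1\}$, $n\equiv \ell \pmod k$, and let $x\in[0,1]$ be a real number such that $xn$ is an integer with $xn\equiv \lfloor n/k\rfloor j+\ell+1 \pmod{\ell+2}$. Let $V$ be an $n$-set with a partition $V=V_1\cup V_2$, $|V_1|=xn$. $H_\ell^j(x)$ is the $k$-graph on $V$ whose edges are all $k$-sets $e$ with $|e\cap V_1|\equiv j \pmod{\ell+2}$. Define $$g(k,d,\ell):=\lim_{n\to\infty}\left(\max_{0\le j\le \ell+1}\max_{x}\ \delta_d(H_\ell^j(x))\Big/\binom{n-d}{k-d}\right),$$ where $n$ runs over integers $n\equiv \ell\pmod k$ and $x$ over the admissible values in $[0,1]$. -}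

module Defs where

open import Data.Fin.Subset using (Subset; inside; outside; ∣_∣; _⊆_; _∩_)
open import Data.Fin.Subset.Properties using (_⊆?_)
open import Data.Integer using (+_)
open import Data.List using (List; []; _∷_; _++_; map; filter; length; upTo)
open import Data.List.Extrema.Nat using (max; min)
open import Data.Nat using (ℕ; zero; suc; _+_; _*_; _∸_; _≤_; _≟_; _/_; ∣_-_∣; NonZero)
open import Data.Nat.Combinatorics using (_C_)
open import Data.Nat.Divisibility using (_∣_; _∣?_)
open import Data.Product using (_×_; proj₁; ∃-syntax)
open import Data.Rational as ℚ using (ℚ; 0ℚ)
open import Data.Vec using ([]; _∷_)
open import Function using (_∘_)
open import Level using (0ℓ)
open import Relation.Binary.PropositionalEquality using (_≡_)
open import Relation.Nullary.Decidable using (Dec; _×-dec_)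
open import Relation.Unary using (Pred; Decidable)

infix 4 _≋_[mod_] _≋?_[mod_]

_≋_[mod_] : ℕ → ℕ → ℕ → Set
a ≋ b [mod m ] = m ∣ ∣ a - b ∣

_≋?_[mod_] : ∀ a b m → Dec (a ≋ b [mod m ])
a ≋? b [mod m ] = m ∣? ∣ a - b ∣

-- The value at [] is a convention; it is never reached once n is large,
-- so it does not affect the limit below.
minimum maximum : List ℕ → ℕ
minimum []       = 0
minimum (x ∷ xs) = min x xs
maximum []       = 0
maximum (x ∷ xs) = max x xs

allSubsets : ∀ n → List (Subset n)
allSubsets zero    = [] ∷ []
allSubsets (suc n) = map (outside ∷_) (allSubsets n) ++ map (inside ∷_) (allSubsets n)

record KGraph (k n : ℕ) : Set₁ where
  field
    Edge    : Pred (Subset n) 0ℓ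
    edge?   : Decidable Edge
    uniform : ∀ {e} → Edge e → ∣ e ∣ ≡ k

deg : ∀ {k n} → KGraph k n → Subset n → ℕ
deg {n = n} H S = length (filter (λ e → edge? e ×-dec S ⊆? e) (allSubsets n))
  where open KGraph H

δ : ∀ {k n} → ℕ → KGraph k n → ℕ
δ {n = n} d H = minimum (map (deg H) (filter (λ S → ∣ S ∣ ≟ d) (allSubsets n)))

-- H_ℓ^j(x), for the partition of the vertex set into V₁ and its complement,
-- where x n = ∣ V₁ ∣.
𝓗 : ∀ k ℓ j {n} → Subset n → KGraph k n
𝓗 k ℓ j V₁ = record
  { Edge    = λ e → ∣ e ∣ ≡ k × ∣ e ∩ V₁ ∣ ≋ j [mod ℓ + 2 ]
  ; edge?   = λ e → (∣ e ∣ ≟ k) ×-dec (∣ e ∩ V₁ ∣ ≋? j [mod ℓ + 2 ])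
  ; uniform = proj₁
  }

module _ (k : ℕ) .{{_ : NonZero k}} (ℓ n : ℕ) where

  -- The parameter x enters only through the integer x n = ∣ V₁ ∣, and for n > 0
  -- the x ∈ [0,1] with x n integral are exactly the quotients ∣ V₁ ∣ / n. Hence
  -- the maximum over admissible x is taken over the sets V₁ of admissible size;
  -- sets of equal size yield isomorphic hypergraphs.
  admissible : ℕ → List (Subset n)
  admissible j =
    filter (λ V₁ → ∣ V₁ ∣ ≋? (n / k) * j + ℓ + 1 [mod ℓ + 2 ]) (allSubsets n)

  maxδ : ℕ → ℕ
  maxδ d = maximum (map (λ j → maximum (map (δ d ∘ 𝓗 k ℓ j) (admissible j)))
                        (upTo (ℓ + 2)))

-- Division with the convention a ÷ 0 = 0.
_÷_ : ℕ → ℕ → ℚ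
a ÷ zero  = 0ℚ
a ÷ suc b = (+ a) ℚ./ suc b

-- Convergence along the n satisfying P. The terms and the limit are rational,
-- so rational ε suffice.
Limit : (P : Pred ℕ 0ℓ) → (ℕ → ℚ) → ℚ → Set
Limit P a L = ∀ ε → 0ℚ ℚ.< ε →
  ∃[ N ] (∀ n → N ≤ n → P n → ℚ.∣ a n ℚ.- L ∣ ℚ.< ε)

-- The limit defining g(k,d,ℓ) exists and equals v.
g[_,_,_]≐_ : ∀ k (d ℓ : ℕ) .{{_ : NonZero k}} → ℚ → Set
g[ k , d , ℓ ]≐ v =
  Limit (λ n → n ≋ ℓ [mod k ]) (λ n → maxδ k ℓ n d ÷ ((n ∸ d) C (k ∸ d))) v

{-# OPTIONS --safe #-}

-- Let S be a d-set. An edge containing S adds k - d vertices to it, where k - d < d and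
-- k - d ≤ ℓ. If both parts have at least d vertices, some value a ∈ [0, d] of ∣ S ∩ V₁ ∣
-- makes a, a + 1, …, a + (k - d) all avoid the residue j, so some S has degree 0. If
-- instead a part W has fewer than d vertices, admissibility of ∣ V₁ ∣ lets one choose
-- ∣ S ∩ W ∣ ∈ {0, 1} such that S ∪ T is not an edge whenever T avoids W. Hence every edge
-- through S uses a further vertex of W, which leaves at most d · C(n - d, k - d - 1)
-- edges: a fraction O(1/n) of C(n - d, k - d).
module Submission where

open import Defs
open import Data.Bool using (true; false)
open import Data.Fin.Subset using (Subset; inside; outside; ∣_∣; _⊆_; _∩_; ∁; ⊥)
open import Data.Fin.Subset.Properties
  using (_⊆?_; drop-∷-⊆; in⊆in; out⊆; p⊆q⇒∣p∣≤∣q∣; p⊂q⇒∣p∣<∣q∣; ∣p∣≤n; ∣p∣≤∣x∷p∣; ∣⊥∣≡0;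
         ∣∁p∣≡n∸∣p∣; x∈p∩q⁺; x∈p∩q⁻; p∩q⊆p; ⊆-trans; _∈?_)
open import Data.Integer as ℤ using (-[1+_])
import Data.Integer.Properties as ℤ
open import Data.List as List using (List; []; _∷_; _++_; map; filter; length)
open import Data.List.Extrema.Nat using (min≤v⁺; max≤v⁺)
import Data.List.Membership.Propositional as List
open import Data.List.Membership.Propositional.Properties
  using (∈-map⁺; ∈-map⁻; ∈-++⁺ˡ; ∈-++⁺ʳ; ∈-filter⁺; ∈-filter⁻; ∈-upTo⁻)
open import Data.List.Properties using (filter-++; length-++; filter-none)
import Data.List.Relation.Unary.All as All
open import Data.List.Relation.Unary.Any as Any using (here; there)
import Data.List.Relation.Binary.Sublist.Heterogeneous.Properties as Sublist
open import Data.List.Relation.Binary.Sublist.Propositional using (⊆-refl)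
open import Data.Nat
open import Data.Nat.Combinatorics using (_C_; nC1≡n; nCk+nC[k+1]≡[n+1]C[k+1])
open import Data.Nat.Divisibility
  using (_∣_; ∣1⇒≡1; ∣m+n∣m⇒∣n; ∣n⇒∣m*n; >⇒∤; divides)
open import Data.Nat.DivMod using (m≡m%n+[m/n]*n; [m+kn]%n≡m%n; m<n⇒m%n≡m)
open import Data.Nat.Properties
open import Data.Nat.Tactic.RingSolver using (solve-∀)
open import Data.Product using (_×_; _,_; proj₁; proj₂; ∃-syntax)
open import Data.Rational as ℚ using (0ℚ; mkℚ)
import Data.Rational.Properties as ℚ
open import Data.Rational.Unnormalised as ℚᵘ using (mkℚᵘ)
import Data.Rational.Unnormalised.Properties as ℚᵘ
open import Data.Sum using (inj₁; inj₂)
open import Data.Vec as Vec using ([]; _∷_)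
open import Function using (_∘_)
open import Level using (0ℓ)
open import Relation.Binary.PropositionalEquality
open import Relation.Nullary using (¬_; yes; no; contradiction; does; ¬?)
open import Relation.Nullary.Decidable using (_×-dec_; decidable-stable)
open import Relation.Unary using (Pred; Decidable)

private variable
  A B : Set
  n : ℕ

-- Binomial coefficients

0<nCk : ∀ {n k} → k ≤ n → 0 < n C k
0<nCk {n}     {zero}  _         = s≤s z≤n
0<nCk {suc n} {suc k} (s≤s k≤n) =
  subst (0 <_) (nCk+nC[k+1]≡[n+1]C[k+1] n k) (<-≤-trans (0<nCk k≤n) (m≤m+n _ _))

nCk≤[1+n]Ck : ∀ n k → n C k ≤ suc n C k
nCk≤[1+n]Ck n zero    = ≤-refl
nCk≤[1+n]Ck n (suc k) =
  subst (n C suc k ≤_) (nCk+nC[k+1]≡[n+1]C[k+1] n k) (m≤n+m _ _)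

-- The absorption identity. Pascal's rule splits the left side, the induction hypotheses at `k` and
-- `suc k` rewrite the pieces, and Pascal's rule merges them again.
[1+k]*[1+n]C[1+k]≡[1+n]*nCk : ∀ n k → suc k * (suc n C suc k) ≡ suc n * (n C k)
[1+k]*[1+n]C[1+k]≡[1+n]*nCk n zero = begin
  suc n C 1 + 0  ≡⟨ +-identityʳ _ ⟩
  suc n C 1      ≡⟨ nC1≡n (suc n) ⟩
  suc n          ≡⟨ *-identityʳ (suc n) ⟨
  suc n * 1      ∎
  where open ≡-Reasoning
[1+k]*[1+n]C[1+k]≡[1+n]*nCk zero    (suc k) = *-zeroʳ k
[1+k]*[1+n]C[1+k]≡[1+n]*nCk (suc n) (suc k) = begin
  suc (suc k) * (suc (suc n) C suc (suc k))
    ≡⟨ cong (suc (suc k) *_) (nCk+nC[k+1]≡[n+1]C[k+1] (suc n) (suc k)) ⟨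
  suc (suc k) * (x + suc n C suc (suc k))
    ≡⟨ *-distribˡ-+ (suc (suc k)) x _ ⟩
  (x + suc k * x) + suc (suc k) * (suc n C suc (suc k))
    ≡⟨ cong₂ (λ a b → (x + a) + b) ([1+k]*[1+n]C[1+k]≡[1+n]*nCk n k)
                                   ([1+k]*[1+n]C[1+k]≡[1+n]*nCk n (suc k)) ⟩
  (x + suc n * (n C k)) + suc n * (n C suc k)
    ≡⟨ +-assoc x _ _ ⟩
  x + (suc n * (n C k) + suc n * (n C suc k))
    ≡⟨ cong (x +_) (*-distribˡ-+ (suc n) (n C k) _) ⟨
  x + suc n * (n C k + n C suc k)
    ≡⟨ cong (λ a → x + suc n * a) (nCk+nC[k+1]≡[n+1]C[k+1] n k) ⟩
  suc (suc n) * x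
    ∎
  where
  open ≡-Reasoning
  x = suc n C suc k

-- A subtraction-free form of (k + 1) C(n, k + 1) = (n - k) C(n, k). Adding `n C k` to both sides
-- reduces it, by Pascal's rule, to absorption.
[1+k]*nC[1+k]+k*nCk≡n*nCk : ∀ n k → suc k * (n C suc k) + k * (n C k) ≡ n * (n C k)
[1+k]*nC[1+k]+k*nCk≡n*nCk n k = +-cancelˡ-≡ (n C k) _ _ (begin
  x + (suc k * y + k * x)    ≡⟨ solve x y k ⟩
  suc k * (x + y)            ≡⟨ cong (suc k *_) (nCk+nC[k+1]≡[n+1]C[k+1] n k) ⟩
  suc k * (suc n C suc k)    ≡⟨ [1+k]*[1+n]C[1+k]≡[1+n]*nCk n k ⟩
  x + n * x                  ∎)
  where
  open ≡-Reasoning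
  x = n C k
  y = n C suc k
  solve : ∀ x y k → x + (suc k * y + k * x) ≡ suc k * (x + y)
  solve = solve-∀

-- The ratio of consecutive binomials is (n - k) / (k + 1), which exceeds `c` once n - k > (k + 1)
-- c. This is the source of the factor O(1/n).
*-nCk<nC[1+k] : ∀ {n} k c → k + suc (suc k * c) ≤ n → c * (n C k) < n C suc k
*-nCk<nC[1+k] {n} k c le = *-cancelˡ-< (suc k) _ _ (+-cancelʳ-< (k * x) _ _ (begin-strict
  suc k * (c * x) + k * x      <⟨ +-monoˡ-< (k * x) (m<m+n (suc k * (c * x)) (0<nCk (≤-trans (m≤m+n k _) le))) ⟩
  (suc k * (c * x) + x) + k * x ≡⟨ solve x k c ⟩
  (k + suc (suc k * c)) * x    ≤⟨ *-monoˡ-≤ x le ⟩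
  n * x                        ≡⟨ [1+k]*nC[1+k]+k*nCk≡n*nCk n k ⟨
  suc k * (n C suc k) + k * x  ∎))
  where
  open ≤-Reasoning
  x = n C k
  solve : ∀ x k c → (suc k * (c * x) + x) + k * x ≡ (k + suc (suc k * c)) * x
  solve = solve-∀

-- Counting subsets

module _ {P Q : Pred A 0ℓ} (P? : Decidable P) (Q? : Decidable Q) where

  length-filter-mono : (∀ x → P x → Q x) → ∀ xs →
                       length (filter P? xs) ≤ length (filter Q? xs)
  length-filter-mono P⇒Q xs = Sublist.length-mono-≤
    (Sublist.⊆-filter-Sublist P? Q? (λ where refl → P⇒Q _) (⊆-refl {x = xs}))

length-filter-map : {P : Pred B 0ℓ} (P? : Decidable P) (f : A → B) (xs : List A) →
                    length (filter P? (map f xs)) ≡ length (filter (P? ∘ f) xs)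
length-filter-map P? f []       = refl
length-filter-map P? f (x ∷ xs) with does (P? (f x))
... | true  = cong suc (length-filter-map P? f xs)
... | false = length-filter-map P? f xs

# : {P : Pred (Subset n) 0ℓ} → Decidable P → ℕ
# {n} P? = length (filter P? (allSubsets n))

module _ {P : Pred (Subset n) 0ℓ} (P? : Decidable P) where

  #-mono : {Q : Pred (Subset n) 0ℓ} (Q? : Decidable Q) → (∀ e → P e → Q e) → # P? ≤ # Q?
  #-mono Q? P⇒Q = length-filter-mono P? Q? P⇒Q (allSubsets n)

  #-none : (∀ e → ¬ P e) → # P? ≡ 0
  #-none ¬P = cong length (filter-none P? (All.universal ¬P (allSubsets n)))

#-suc : {P : Pred (Subset (suc n)) 0ℓ} (P? : Decidable P) →
        # P? ≡ # (P? ∘ (outside ∷_)) + # (P? ∘ (inside ∷_))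
#-suc {n} P? = begin
  length (filter P? (outs ++ ins))                   ≡⟨ cong length (filter-++ P? outs ins) ⟩
  length (filter P? outs ++ filter P? ins)           ≡⟨ length-++ (filter P? outs) ⟩
  length (filter P? outs) + length (filter P? ins)   ≡⟨ cong₂ _+_ (length-filter-map P? _ (allSubsets n))
                                                                  (length-filter-map P? _ (allSubsets n)) ⟩
  # (P? ∘ (outside ∷_)) + # (P? ∘ (inside ∷_))       ∎
  where
  open ≡-Reasoning
  outs = map (outside ∷_) (allSubsets n)
  ins  = map (inside  ∷_) (allSubsets n)

∈-allSubsets : (S : Subset n) → S List.∈ allSubsets n
∈-allSubsets []            = here refl
∈-allSubsets (outside ∷ S) = ∈-++⁺ˡ (∈-map⁺ _ (∈-allSubsets S))
∈-allSubsets (inside  ∷ S) = ∈-++⁺ʳ _ (∈-map⁺ _ (∈-allSubsets S))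

in⊈out : ∀ {S T : Subset n} → ¬ (inside ∷ S ⊆ outside ∷ T)
in⊈out S⊆T with S⊆T Vec.here
... | ()

superset? : (S : Subset n) (k : ℕ) → Decidable (λ e → ∣ e ∣ ≡ k × S ⊆ e)
superset? S k e = (∣ e ∣ ≟ k) ×-dec (S ⊆? e)

#-superset≤ : (S : Subset n) (r : ℕ) → # (superset? S (∣ S ∣ + r)) ≤ (n ∸ ∣ S ∣) C r
#-superset≤ []            zero    = ≤-refl
#-superset≤ []            (suc r) = ≤-refl
#-superset≤ (inside ∷ S)  r       = begin
  # P?                                          ≡⟨ #-suc P? ⟩
  # (P? ∘ (outside ∷_)) + # (P? ∘ (inside ∷_))  ≤⟨ +-mono-≤ (≤-reflexive (#-none (P? ∘ (outside ∷_)) λ _ → in⊈out ∘ proj₂))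
                                                            (#-mono (P? ∘ (inside ∷_)) (superset? S (∣ S ∣ + r))
                                                              λ _ (eq , ⊆e) → suc-injective eq , drop-∷-⊆ ⊆e) ⟩
  # (superset? S (∣ S ∣ + r))                   ≤⟨ #-superset≤ S r ⟩
  _                                             ∎
  where
  open ≤-Reasoning
  P? = superset? (inside ∷ S) (suc (∣ S ∣ + r))
#-superset≤ {suc n} (outside ∷ S) zero = begin
  -- No vertex is left to choose: a superset of `S` that used this one would have too few vertices
  -- elsewhere to cover `S`.
  # P?                                          ≡⟨ #-suc P? ⟩
  # (P? ∘ (outside ∷_)) + # (P? ∘ (inside ∷_))  ≤⟨ +-mono-≤ (#-mono (P? ∘ (outside ∷_)) (superset? S (∣ S ∣ + 0))
                                                              λ _ (eq , ⊆e) → eq , drop-∷-⊆ ⊆e)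
                                                            (≤-reflexive (#-none (P? ∘ (inside ∷_)) λ e (eq , ⊆e) →
                                                              <⇒≱ (≤-reflexive (trans eq (+-identityʳ _))) (p⊆q⇒∣p∣≤∣q∣ (drop-∷-⊆ ⊆e)))) ⟩
  # (superset? S (∣ S ∣ + 0)) + 0               ≡⟨ +-identityʳ _ ⟩
  # (superset? S (∣ S ∣ + 0))                   ≤⟨ #-superset≤ S zero ⟩
  1                                             ∎
  where
  open ≤-Reasoning
  P? = superset? (outside ∷ S) (∣ S ∣ + 0)
#-superset≤ {suc n} (outside ∷ S) (suc r) = begin
  -- A vertex outside `S` is skipped or chosen; the two bounds add up by Pascal's rule.
  # P?                                          ≡⟨ #-suc P? ⟩
  # (P? ∘ (outside ∷_)) + # (P? ∘ (inside ∷_))  ≤⟨ +-mono-≤ (#-mono (P? ∘ (outside ∷_)) (superset? S (∣ S ∣ + suc r))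
                                                              λ _ (eq , ⊆e) → eq , drop-∷-⊆ ⊆e)
                                                            (#-mono (P? ∘ (inside ∷_)) (superset? S (∣ S ∣ + r))
                                                              λ _ (eq , ⊆e) → suc-injective (trans eq (+-suc _ r)) , drop-∷-⊆ ⊆e) ⟩
  # (superset? S (∣ S ∣ + suc r)) + # (superset? S (∣ S ∣ + r))
                                                ≤⟨ +-mono-≤ (#-superset≤ S (suc r)) (#-superset≤ S r) ⟩
  (n ∸ ∣ S ∣) C suc r + (n ∸ ∣ S ∣) C r         ≡⟨ +-comm _ ((n ∸ ∣ S ∣) C r) ⟩
  (n ∸ ∣ S ∣) C r + (n ∸ ∣ S ∣) C suc r         ≡⟨ nCk+nC[k+1]≡[n+1]C[k+1] (n ∸ ∣ S ∣) r ⟩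
  suc (n ∸ ∣ S ∣) C suc r                       ≡⟨ cong (_C suc r) (+-∸-assoc 1 (∣p∣≤n S)) ⟨
  (suc n ∸ ∣ S ∣) C suc r                       ∎
  where
  open ≤-Reasoning
  P? = superset? (outside ∷ S) (∣ S ∣ + suc r)

-- The supersets of S that meet W outside S.
escaping? : (S W : Subset n) (k : ℕ) → Decidable (λ e → ∣ e ∣ ≡ k × S ⊆ e × ¬ (e ∩ W ⊆ S))
escaping? S W k e = (∣ e ∣ ≟ k) ×-dec ((S ⊆? e) ×-dec (¬? (e ∩ W ⊆? S)))

⊆∧∣∣≡⇒⊇ : {S e : Subset n} → S ⊆ e → ∣ e ∣ ≡ ∣ S ∣ → e ⊆ S
⊆∧∣∣≡⇒⊇ {S = S} S⊆e eq {x} x∈e =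
  decidable-stable (x ∈? S) λ x∉S → <⇒≢ (p⊂q⇒∣p∣<∣q∣ (S⊆e , x , x∈e , x∉S)) (sym eq)

-- After a vertex of W outside S is fixed, only r of the r + 1 further vertices
-- remain to be chosen.
#-escaping≤ : (S W : Subset n) (r : ℕ) →
              # (escaping? S W (∣ S ∣ + suc r)) ≤ ∣ W ∣ * ((n ∸ ∣ S ∣) C r)
#-escaping≤ []            []            r       = ≤-refl
#-escaping≤ {suc n} (inside ∷ S)  (w ∷ W) r = begin
  # P?                                          ≡⟨ #-suc P? ⟩
  # (P? ∘ (outside ∷_)) + # (P? ∘ (inside ∷_))  ≤⟨ +-mono-≤ (≤-reflexive (#-none (P? ∘ (outside ∷_)) λ _ → in⊈out ∘ proj₁ ∘ proj₂))
                                                            (#-mono (P? ∘ (inside ∷_)) (escaping? S W (∣ S ∣ + suc r))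
                                                              λ e (eq , ⊆e , esc) → suc-injective eq , drop-∷-⊆ ⊆e , esc ∘ cons w e) ⟩
  # (escaping? S W (∣ S ∣ + suc r))             ≤⟨ #-escaping≤ S W r ⟩
  ∣ W ∣ * ((n ∸ ∣ S ∣) C r)                     ≤⟨ *-monoˡ-≤ _ (∣p∣≤∣x∷p∣ w W) ⟩
  ∣ w ∷ W ∣ * ((n ∸ ∣ S ∣) C r)                 ∎
  where
  open ≤-Reasoning
  P? = escaping? (inside ∷ S) (w ∷ W) (suc (∣ S ∣ + suc r))
  cons : ∀ w e → e ∩ W ⊆ S → (inside ∷ e) ∩ (w ∷ W) ⊆ inside ∷ S
  cons inside  e = in⊆in
  cons outside e = out⊆
#-escaping≤ {suc n} (outside ∷ S) (inside ∷ W) r = begin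
  -- Choosing this vertex is already an escape, so those `e` are counted as plain supersets with `r`
  -- further vertices. The extra vertex of `W` pays for them.
  # P?                                          ≡⟨ #-suc P? ⟩
  # (P? ∘ (outside ∷_)) + # (P? ∘ (inside ∷_))  ≤⟨ +-mono-≤ (#-mono (P? ∘ (outside ∷_)) (escaping? S W (∣ S ∣ + suc r))
                                                              λ e (eq , ⊆e , esc) → eq , drop-∷-⊆ ⊆e , esc ∘ out⊆)
                                                            (#-mono (P? ∘ (inside ∷_)) (superset? S (∣ S ∣ + r))
                                                              λ e (eq , ⊆e , _) → suc-injective (trans eq (+-suc _ r)) , drop-∷-⊆ ⊆e) ⟩
  # (escaping? S W (∣ S ∣ + suc r)) + # (superset? S (∣ S ∣ + r))
                                                ≤⟨ +-mono-≤ (#-escaping≤ S W r) (#-superset≤ S r) ⟩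
  ∣ W ∣ * ((n ∸ ∣ S ∣) C r) + (n ∸ ∣ S ∣) C r   ≡⟨ +-comm _ ((n ∸ ∣ S ∣) C r) ⟩
  suc ∣ W ∣ * ((n ∸ ∣ S ∣) C r)                 ≤⟨ *-monoʳ-≤ (suc ∣ W ∣) (nCk≤[1+n]Ck (n ∸ ∣ S ∣) r) ⟩
  suc ∣ W ∣ * (suc (n ∸ ∣ S ∣) C r)             ≡⟨ cong (λ m → suc ∣ W ∣ * (m C r)) (+-∸-assoc 1 (∣p∣≤n S)) ⟨
  suc ∣ W ∣ * ((suc n ∸ ∣ S ∣) C r)             ∎
  where
  open ≤-Reasoning
  P? = escaping? (outside ∷ S) (inside ∷ W) (∣ S ∣ + suc r)
#-escaping≤ {suc n} (outside ∷ S) (outside ∷ W) zero = begin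
  -- With `r = 0` a single vertex is added to `S`; spending it outside `W` leaves `e` equal to `S`
  -- elsewhere, so nothing escapes.
  # P?                                          ≡⟨ #-suc P? ⟩
  # (P? ∘ (outside ∷_)) + # (P? ∘ (inside ∷_))  ≤⟨ +-mono-≤ (#-mono (P? ∘ (outside ∷_)) (escaping? S W (∣ S ∣ + 1))
                                                              λ e (eq , ⊆e , esc) → eq , drop-∷-⊆ ⊆e , esc ∘ out⊆)
                                                            (≤-reflexive (#-none (P? ∘ (inside ∷_)) λ e (eq , ⊆e , esc) →
                                                              esc (out⊆ (⊆-trans (p∩q⊆p e W)
                                                                (⊆∧∣∣≡⇒⊇ (drop-∷-⊆ ⊆e) (suc-injective (trans eq (+-comm _ 1)))))))) ⟩
  # (escaping? S W (∣ S ∣ + 1)) + 0             ≡⟨ +-identityʳ _ ⟩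
  # (escaping? S W (∣ S ∣ + 1))                 ≤⟨ #-escaping≤ S W zero ⟩
  ∣ W ∣ * 1                                     ∎
  where
  open ≤-Reasoning
  P? = escaping? (outside ∷ S) (outside ∷ W) (∣ S ∣ + 1)
#-escaping≤ {suc n} (outside ∷ S) (outside ∷ W) (suc r) = begin
  -- The vertex lies outside both sets, so the escape is left to the tail in either case: the factor
  -- `∣ W ∣` stays and Pascal's rule acts on the other one.
  # P?                                          ≡⟨ #-suc P? ⟩
  # (P? ∘ (outside ∷_)) + # (P? ∘ (inside ∷_))  ≤⟨ +-mono-≤ (#-mono (P? ∘ (outside ∷_)) (escaping? S W (∣ S ∣ + suc (suc r)))
                                                              λ e (eq , ⊆e , esc) → eq , drop-∷-⊆ ⊆e , esc ∘ out⊆)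
                                                            (#-mono (P? ∘ (inside ∷_)) (escaping? S W (∣ S ∣ + suc r))
                                                              λ e (eq , ⊆e , esc) → suc-injective (trans eq (+-suc _ (suc r))) , drop-∷-⊆ ⊆e , esc ∘ out⊆) ⟩
  # (escaping? S W (∣ S ∣ + suc (suc r))) + # (escaping? S W (∣ S ∣ + suc r))
                                                ≤⟨ +-mono-≤ (#-escaping≤ S W (suc r)) (#-escaping≤ S W r) ⟩
  ∣ W ∣ * (m C suc r) + ∣ W ∣ * (m C r)         ≡⟨ *-distribˡ-+ ∣ W ∣ (m C suc r) _ ⟨
  ∣ W ∣ * (m C suc r + m C r)                   ≡⟨ cong (∣ W ∣ *_) (+-comm (m C suc r) _) ⟩
  ∣ W ∣ * (m C r + m C suc r)                   ≡⟨ cong (∣ W ∣ *_) (nCk+nC[k+1]≡[n+1]C[k+1] m r) ⟩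
  ∣ W ∣ * (suc m C suc r)                       ≡⟨ cong (λ m → ∣ W ∣ * (m C suc r)) (+-∸-assoc 1 (∣p∣≤n S)) ⟨
  ∣ W ∣ * ((suc n ∸ ∣ S ∣) C suc r)             ∎
  where
  open ≤-Reasoning
  m = n ∸ ∣ S ∣
  P? = escaping? (outside ∷ S) (outside ∷ W) (∣ S ∣ + suc (suc r))

-- Subsets with a prescribed profile

∣p∩q∣+∣p∩∁q∣≡∣p∣ : (p q : Subset n) → ∣ p ∩ q ∣ + ∣ p ∩ ∁ q ∣ ≡ ∣ p ∣
∣p∩q∣+∣p∩∁q∣≡∣p∣ []            []            = refl
∣p∩q∣+∣p∩∁q∣≡∣p∣ (outside ∷ p) (_ ∷ q)       = ∣p∩q∣+∣p∩∁q∣≡∣p∣ p q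
∣p∩q∣+∣p∩∁q∣≡∣p∣ (inside ∷ p)  (inside ∷ q)  = cong suc (∣p∩q∣+∣p∩∁q∣≡∣p∣ p q)
∣p∩q∣+∣p∩∁q∣≡∣p∣ (inside ∷ p)  (outside ∷ q) =
  trans (+-suc ∣ p ∩ q ∣ _) (cong suc (∣p∩q∣+∣p∩∁q∣≡∣p∣ p q))

∣p∣+∣∁p∣≡n : (p : Subset n) → ∣ p ∣ + ∣ ∁ p ∣ ≡ n
∣p∣+∣∁p∣≡n p = trans (cong (∣ p ∣ +_) (∣∁p∣≡n∸∣p∣ p)) (m+[n∸m]≡n (∣p∣≤n p))

subset-with-profile : (V : Subset n) (a b : ℕ) → a ≤ ∣ V ∣ → b ≤ ∣ ∁ V ∣ →
                      ∃[ S ] (∣ S ∩ V ∣ ≡ a × ∣ S ∩ ∁ V ∣ ≡ b)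
subset-with-profile []            zero    zero    _         _         = [] , refl , refl
subset-with-profile (inside ∷ V)  zero    b       _         b≤        with subset-with-profile V 0 b z≤n b≤
... | S , p , q = outside ∷ S , p , q
subset-with-profile (inside ∷ V)  (suc a) b       (s≤s a≤)  b≤        with subset-with-profile V a b a≤ b≤
... | S , p , q = inside ∷ S , cong suc p , q
subset-with-profile (outside ∷ V) a       zero    a≤        _         with subset-with-profile V a 0 a≤ z≤n
... | S , p , q = outside ∷ S , p , q
subset-with-profile (outside ∷ V) a       (suc b) a≤        (s≤s b≤)  with subset-with-profile V a b a≤ b≤
... | S , p , q = inside ∷ S , p , cong suc q

∩-monoˡ-⊆ : {p q : Subset n} (r : Subset n) → p ⊆ q → p ∩ r ⊆ q ∩ r
∩-monoˡ-⊆ {p = p} r p⊆q x∈ with x∈p∩q⁻ p r x∈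
... | x∈p , x∈r = x∈p∩q⁺ (p⊆q x∈p , x∈r)

-- The counterpart of `escaping?`: for trapped sets `S` alone fixes the count in `W`, so one good
-- value of `∣ S ∩ W ∣` excludes all trapped edges at once.
trapped⇒∣∩∣≡ : {S e W : Subset n} → S ⊆ e → e ∩ W ⊆ S → ∣ e ∩ W ∣ ≡ ∣ S ∩ W ∣
trapped⇒∣∩∣≡ {S = S} {e} {W} S⊆e e∩W⊆S = ≤-antisym
  (p⊆q⇒∣p∣≤∣q∣ λ x∈ → x∈p∩q⁺ (e∩W⊆S x∈ , proj₂ (x∈p∩q⁻ e W x∈)))
  (p⊆q⇒∣p∣≤∣q∣ (∩-monoˡ-⊆ W S⊆e))

-- Residues

-- Two distances that differ by 1 cannot both be multiples of `m > 1`. Hence of two adjacent counts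
-- at least one avoids a given residue.
≋-consecutive : ∀ {m} x y → 1 < m → x ≋ y [mod m ] → ¬ (suc x ≋ y [mod m ])
≋-consecutive {m} x y 1<m p q = <⇒≢ 1<m (sym (∣1⇒≡1 (m∣1 x y p q)))
  where
  -- Peeling successors off both arguments preserves the distances; once one argument is zero, the
  -- absolute values disappear and the difference 1 is visible.
  m∣1 : ∀ x y → m ∣ ∣ x - y ∣ → m ∣ ∣ suc x - y ∣ → m ∣ 1
  m∣1 zero    zero    p q = q
  m∣1 zero    (suc y) p q = ∣m+n∣m⇒∣n (subst (m ∣_) (+-comm 1 y) p) q
  m∣1 (suc x) zero    p q = ∣m+n∣m⇒∣n (subst (m ∣_) (+-comm 1 (suc x)) q) p
  m∣1 (suc x) (suc y) p q = m∣1 x y p q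

-- The window `a, …, a + s` is placed between consecutive members of the class of `j`: it starts at
-- 0 if it then ends before `j`, and otherwise just after `j`, where `suc s < m` makes it end before
-- `j + m`. Either way all distances to `j` lie strictly between 0 and `m`.
avoid-residues : ∀ {m} j s → j < m → suc s < m →
                 ∃[ a ] (a ≤ suc s × (∀ b → b ≤ s → ¬ (a + b ≋ j [mod m ])))
avoid-residues {m} j s j<m 1+s<m with s <? j
... | yes s<j = 0 , z≤n , λ b b≤s m∣ → >⇒∤ {{>-nonZero (m<n⇒0<n∸m (≤-<-trans b≤s s<j))}}
        (≤-<-trans (m∸n≤m j b) j<m)
        (subst (m ∣_) (m≤n⇒∣m-n∣≡n∸m (≤-trans b≤s (<⇒≤ s<j))) m∣)
... | no  s≮j = suc j , s≤s (≮⇒≥ s≮j) , λ b b≤s m∣ → >⇒∤ (≤-<-trans (s≤s b≤s) 1+s<m)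
        (subst (m ∣_) (trans (cong₂ ∣_-_∣ (sym (+-suc j b)) (sym (+-identityʳ j)))
                             (trans (∣m+n-m+o∣≡∣n-o∣ j (suc b) 0) (∣-∣-identityʳ _))) m∣)

module _ (k ℓ q j : ℕ) where

  private
    M = ℓ + 2

    1<M : 1 < M
    1<M = m≤n+m 2 ℓ

  -- For ∣ V₁ ∣ = 0 the only choice is 0; it works because admissibility
  -- excludes j ≡ 0.
  avoid-residue-small : ∀ v → v ≋ q * j + ℓ + 1 [mod M ] →
                        ∃[ a ] (a ≤ v × a ≤ 1 × ¬ (a ≋ j [mod M ]))
  -- If `M` divided `j`, admissibility, here `M ∣ q * j + ℓ + 1`, would leave `M ∣ ℓ + 1`, although
  -- `0 < ℓ + 1 < M`.
  avoid-residue-small zero    adm = 0 , z≤n , z≤n , λ M∣j →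
    >⇒∤ {{>-nonZero (m≤n+m 1 ℓ)}} (+-monoʳ-< ℓ ≤-refl)
      (∣m+n∣m⇒∣n (subst (M ∣_) (+-assoc (q * j) ℓ 1) adm) (∣n⇒∣m*n q M∣j))
  avoid-residue-small (suc v) adm with 0 ≋? j [mod M ]
  ... | no  0≢j = 0 , z≤n , z≤n , 0≢j
  ... | yes 0≡j = 1 , s≤s z≤n , ≤-refl , ≋-consecutive 0 j 1<M 0≡j

  -- For ∣ V₂ ∣ = 0, admissibility and n = ℓ + q k exclude j ≡ k.
  avoid-residue-large : ∀ v w → v + w ≡ ℓ + q * k → v ≋ q * j + ℓ + 1 [mod M ] → 1 ≤ k →
                        ∃[ b ] (b ≤ w × b ≤ 1 × ¬ (k ∸ b ≋ j [mod M ]))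
  -- From `k ≡ j` follows `ℓ + q * k ≡ ℓ + q * j`, whereas admissibility of `v = ℓ + q * k` puts it
  -- in the adjacent class of `ℓ + q * j + 1`.
  avoid-residue-large v zero n≡ adm 1≤k = 0 , z≤n , z≤n , λ k≡j →
    ≋-consecutive (ℓ + q * k) (suc (ℓ + q * j)) 1<M
      (subst₂ (_≋_[mod M ]) (trans (sym (+-identityʳ v)) n≡)
                            (trans (+-comm (q * j + ℓ) 1) (cong suc (+-comm (q * j) ℓ))) adm)
      (subst (M ∣_) (trans (*-distribˡ-∣-∣ q k j) (sym (∣m+n-m+o∣≡∣n-o∣ ℓ (q * k) (q * j))))
             (∣n⇒∣m*n q k≡j))
  avoid-residue-large v (suc w) n≡ adm 1≤k with k ≋? j [mod M ]
  ... | no  k≢j = 0 , z≤n , z≤n , k≢j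
  ... | yes k≡j = 1 , s≤s z≤n , ≤-refl , λ k∸1≡j →
    ≋-consecutive (k ∸ 1) j 1<M k∸1≡j (subst (_≋ j [mod M ]) (sym (m+[n∸m]≡n 1≤k)) k≡j)

-- The minimum degree

δ≤deg : ∀ {k} d (H : KGraph k n) (S : Subset n) → ∣ S ∣ ≡ d → δ d H ≤ deg H S
δ≤deg {n} d H S ∣S∣≡d =
  minimum≤ (∈-map⁺ (deg H) (∈-filter⁺ (λ S → ∣ S ∣ ≟ d) (∈-allSubsets S) ∣S∣≡d))
  where
  minimum≤ : ∀ {x xs} → x List.∈ xs → minimum xs ≤ x
  minimum≤ {xs = x ∷ xs} (here refl) = min≤v⁺ x xs (inj₁ ≤-refl)
  minimum≤ {xs = x ∷ xs} (there x∈)  = min≤v⁺ x xs (inj₂ (Any.map (≤-reflexive ∘ sym) x∈))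

maximum≤ : ∀ {v} xs → (∀ x → x List.∈ xs → x ≤ v) → maximum xs ≤ v
maximum≤ []       h = z≤n
maximum≤ (x ∷ xs) h = max≤v⁺ (h x (here refl)) (All.tabulate λ y∈ → h _ (there y∈))

module _ (d r ℓ j : ℕ) (V : Subset n) where

  private
    k = d + suc r
    M = ℓ + 2

  -- The common interface of all cases: one well-chosen `S` bounds the minimum degree. For `W = ⊥`
  -- every set is trapped, so the last hypothesis then says that no edge contains `S`.
  δ≤-of-escaping : (S W : Subset n) → ∣ S ∣ ≡ d → ∣ W ∣ ≤ d →
    (∀ e → ∣ e ∣ ≡ k → S ⊆ e → ∣ e ∩ V ∣ ≋ j [mod M ] → ¬ (e ∩ W ⊆ S)) →
    δ d (𝓗 k ℓ j V) ≤ d * ((n ∸ d) C r)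
  δ≤-of-escaping S W refl ∣W∣≤d esc = begin
    δ d (𝓗 k ℓ j V)                ≤⟨ δ≤deg d (𝓗 k ℓ j V) S refl ⟩
    deg (𝓗 k ℓ j V) S              ≤⟨ #-mono _ (escaping? S W k) (λ e ((eq , ≡j) , S⊆e) → eq , S⊆e , esc e eq S⊆e ≡j) ⟩
    # (escaping? S W k)            ≤⟨ #-escaping≤ S W r ⟩
    ∣ W ∣ * ((n ∸ d) C r)          ≤⟨ *-monoˡ-≤ _ ∣W∣≤d ⟩
    d * ((n ∸ d) C r)              ∎
    where open ≤-Reasoning

  module _ (j<M : j < M) (r<ℓ : suc r ≤ ℓ) (r+1<d : suc r < d) where

    δ≤-balanced : d ≤ ∣ V ∣ → d ≤ ∣ ∁ V ∣ → δ d (𝓗 k ℓ j V) ≤ d * ((n ∸ d) C r)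
    δ≤-balanced d≤V d≤∁V
      -- The window length comes from the `suc r` vertices that an edge adds to `S`. It fits modulo
      -- `M` because `suc r ≤ ℓ`, and `a ≤ suc (suc r) ≤ d` leaves room for `a` inside `S`.
      with a , a≤ , avoid ← avoid-residues {M} j (suc r) j<M
                              (≤-trans (s≤s (s≤s r<ℓ)) (≤-reflexive (+-comm 2 ℓ)))
      with S , S∩V , S∩∁V ← subset-with-profile V a (d ∸ a) (≤-trans (≤-trans a≤ r+1<d) d≤V)
                              (≤-trans (m∸n≤m d a) d≤∁V)
      = δ≤-of-escaping S ⊥ ∣S∣≡d (≤-trans (≤-reflexive (∣⊥∣≡0 n)) z≤n) esc
      where
      a≤d = ≤-trans a≤ r+1<d
      ∣S∣≡d : ∣ S ∣ ≡ d
      ∣S∣≡d = trans (sym (∣p∩q∣+∣p∩∁q∣≡∣p∣ S V)) (trans (cong₂ _+_ S∩V S∩∁V) (m+[n∸m]≡n a≤d))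
      esc : ∀ e → ∣ e ∣ ≡ k → S ⊆ e → ∣ e ∩ V ∣ ≋ j [mod M ] → ¬ (e ∩ ⊥ ⊆ S)
      esc e ∣e∣≡k S⊆e ≡j _ = avoid (∣ e ∩ V ∣ ∸ a) (m≤n+o⇒m∸n≤o _ a ≤a+s)
        (subst (_≋ j [mod M ]) (sym (m+[n∸m]≡n a≤∣e∩V∣)) ≡j)
        where
        a≤∣e∩V∣ : a ≤ ∣ e ∩ V ∣
        a≤∣e∩V∣ = subst (_≤ ∣ e ∩ V ∣) S∩V (p⊆q⇒∣p∣≤∣q∣ (∩-monoˡ-⊆ V S⊆e))
        -- At least `d ∸ a` vertices of `e` lie outside `V`, namely those of `S`; the other
        -- `a + suc r` bound the count in `V`.
        ≤a+s : ∣ e ∩ V ∣ ≤ a + suc r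
        ≤a+s = +-cancelˡ-≤ (d ∸ a) _ _ (begin
          d ∸ a + ∣ e ∩ V ∣            ≡⟨ cong (_+ ∣ e ∩ V ∣) S∩∁V ⟨
          ∣ S ∩ ∁ V ∣ + ∣ e ∩ V ∣      ≤⟨ +-monoˡ-≤ _ (p⊆q⇒∣p∣≤∣q∣ (∩-monoˡ-⊆ (∁ V) S⊆e)) ⟩
          ∣ e ∩ ∁ V ∣ + ∣ e ∩ V ∣      ≡⟨ +-comm ∣ e ∩ ∁ V ∣ _ ⟩
          ∣ e ∩ V ∣ + ∣ e ∩ ∁ V ∣      ≡⟨ ∣p∩q∣+∣p∩∁q∣≡∣p∣ e V ⟩
          ∣ e ∣                        ≡⟨ ∣e∣≡k ⟩
          d + suc r                    ≡⟨ cong (_+ suc r) (m∸n+n≡m a≤d) ⟨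
          (d ∸ a) + a + suc r          ≡⟨ +-assoc (d ∸ a) a _ ⟩
          (d ∸ a) + (a + suc r)        ∎)
          where open ≤-Reasoning

  module _ (q : ℕ) (1≤d : 1 ≤ d) (adm : ∣ V ∣ ≋ q * j + ℓ + 1 [mod M ]) where

    -- Here `W = V`: a trapped edge would meet `V` in exactly `a` vertices, and `a` avoids the
    -- residue `j`.
    δ≤-small : ∣ V ∣ < d → d ≤ ∣ ∁ V ∣ → δ d (𝓗 k ℓ j V) ≤ d * ((n ∸ d) C r)
    δ≤-small V<d d≤∁V
      with a , a≤V , a≤1 , a≢j ← avoid-residue-small k ℓ q j ∣ V ∣ adm
      with S , S∩V , S∩∁V ← subset-with-profile V a (d ∸ a) a≤V (≤-trans (m∸n≤m d a) d≤∁V)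
      = δ≤-of-escaping S V
          (trans (sym (∣p∩q∣+∣p∩∁q∣≡∣p∣ S V)) (trans (cong₂ _+_ S∩V S∩∁V) (m+[n∸m]≡n (≤-trans a≤1 1≤d))))
          (<⇒≤ V<d)
          λ e _ S⊆e ≡j trapped → a≢j (subst (_≋ j [mod M ]) (trans (trapped⇒∣∩∣≡ S⊆e trapped) S∩V) ≡j)

    -- Here `W = ∁ V`: a trapped edge has exactly `b` vertices outside `V`, hence `k ∸ b` inside,
    -- which avoids the residue `j`.
    δ≤-large : n ≡ ℓ + q * k → d ≤ ∣ V ∣ → ∣ ∁ V ∣ < d → δ d (𝓗 k ℓ j V) ≤ d * ((n ∸ d) C r)
    δ≤-large n≡ d≤V ∁V<d
      with b , b≤∁V , b≤1 , b≢j ← avoid-residue-large k ℓ q j ∣ V ∣ ∣ ∁ V ∣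
                                    (trans (∣p∣+∣∁p∣≡n V) n≡) adm (≤-trans 1≤d (m≤m+n d _))
      with S , S∩V , S∩∁V ← subset-with-profile V (d ∸ b) b (≤-trans (m∸n≤m d b) d≤V) b≤∁V
      = δ≤-of-escaping S (∁ V)
          (trans (sym (∣p∩q∣+∣p∩∁q∣≡∣p∣ S V)) (trans (cong₂ _+_ S∩V S∩∁V) (m∸n+n≡m (≤-trans b≤1 1≤d))))
          (<⇒≤ ∁V<d)
          λ e ∣e∣≡k S⊆e ≡j trapped → b≢j (subst (_≋ j [mod M ]) (begin
            ∣ e ∩ V ∣                              ≡⟨ m+n∸n≡m ∣ e ∩ V ∣ ∣ e ∩ ∁ V ∣ ⟨
            ∣ e ∩ V ∣ + ∣ e ∩ ∁ V ∣ ∸ ∣ e ∩ ∁ V ∣  ≡⟨ cong₂ _∸_ (trans (∣p∩q∣+∣p∩∁q∣≡∣p∣ e V) ∣e∣≡k)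
                                                                (trans (trapped⇒∣∩∣≡ S⊆e trapped) S∩∁V) ⟩
            k ∸ b                                  ∎) ≡j)
      where open ≡-Reasoning

  δ-𝓗≤ : ∀ q → j < M → suc r ≤ ℓ → suc r < d → d + d ≤ n → n ≡ ℓ + q * k →
          ∣ V ∣ ≋ q * j + ℓ + 1 [mod M ] → δ d (𝓗 k ℓ j V) ≤ d * ((n ∸ d) C r)
  δ-𝓗≤ q j<M r<ℓ r+1<d 2d≤n n≡ adm with d ≤? ∣ V ∣ | d ≤? ∣ ∁ V ∣
  ... | yes d≤V | yes d≤∁V = δ≤-balanced j<M r<ℓ r+1<d d≤V d≤∁V
  ... | no  d≰V | yes d≤∁V = δ≤-small q (≤-trans (s≤s z≤n) r+1<d) adm (≰⇒> d≰V) d≤∁V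
  ... | yes d≤V | no  d≰∁V = δ≤-large q (≤-trans (s≤s z≤n) r+1<d) adm n≡ d≤V (≰⇒> d≰∁V)
  -- Two parts smaller than `d` cannot cover `n ≥ d + d` vertices.
  ... | no  d≰V | no  d≰∁V =
    contradiction (+-mono-< (≰⇒> d≰V) (≰⇒> d≰∁V))
                  (≤⇒≯ (≤-trans 2d≤n (≤-reflexive (sym (∣p∣+∣∁p∣≡n V)))))

-- The bound does not depend on `j` or `V`, so it passes through both maxima; the `q` of the residue
-- lemmas becomes `n / k`.
maxδ≤ : ∀ k .{{_ : NonZero k}} d r ℓ n → k ≡ d + suc r → suc r ≤ ℓ → suc r < d → d + d ≤ n →
        n ≡ ℓ + (n / k) * k → maxδ k ℓ n d ≤ d * ((n ∸ d) C r)
maxδ≤ k d r ℓ n refl r<ℓ r+1<d 2d≤n n≡ = maximum≤ _ λ x x∈ → bound-j x (∈-map⁻ _ x∈)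
  where
  bound = d * ((n ∸ d) C r)
  bound-j : ∀ x → ∃[ j ] (j List.∈ List.upTo (ℓ + 2) ×
                          x ≡ maximum (map (δ d ∘ 𝓗 k ℓ j) (admissible k ℓ n j))) → x ≤ bound
  bound-j _ (j , j∈ , refl) = maximum≤ _ λ y y∈ → bound-V y (∈-map⁻ _ y∈)
    where
    bound-V : ∀ y → ∃[ V ] (V List.∈ admissible k ℓ n j × y ≡ δ d (𝓗 k ℓ j V)) → y ≤ bound
    bound-V _ (V , V∈ , refl) = δ-𝓗≤ d r ℓ j V (n / k) (∈-upTo⁻ j∈) r<ℓ r+1<d 2d≤n n≡
      (proj₂ (∈-filter⁻ (λ V₁ → ∣ V₁ ∣ ≋? (n / k) * j + ℓ + 1 [mod ℓ + 2 ]) {xs = allSubsets n} V∈))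

-- Passage to the limit

≋⇒≡+quotient : ∀ k .{{_ : NonZero k}} {ℓ n} → ℓ < k → ℓ ≤ n → n ≋ ℓ [mod k ] →
               n ≡ ℓ + (n / k) * k
≋⇒≡+quotient k {ℓ} {n} ℓ<k ℓ≤n (divides q eq) = trans (m≡m%n+[m/n]*n n k) (cong (_+ (n / k) * k) n%k≡ℓ)
  where
  n≡ℓ+qk : n ≡ ℓ + q * k
  n≡ℓ+qk = trans (sym (m+[n∸m]≡n ℓ≤n)) (cong (ℓ +_) (trans (sym (m≤n⇒∣n-m∣≡n∸m ℓ≤n)) eq))
  n%k≡ℓ : n % k ≡ ℓ
  n%k≡ℓ = trans (cong (_% k) n≡ℓ+qk) (trans ([m+kn]%n≡m%n ℓ q k) (m<n⇒m%n≡m ℓ<k))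

-- A positive `ε` has numerator at least 1, so it is enough that `a / b` lies below the reciprocal
-- of its denominator. This reduces the limit to an inequality in ℕ.
÷-< : ∀ a b ε → 0ℚ ℚ.< ε → a * ℚ.↧ₙ ε < b → ℚ.∣ a ÷ b ℚ.- 0ℚ ∣ ℚ.< ε
÷-< a (suc b) (mkℚ (ℤ.+ 0)  _ _)     (ℚ.*<* (ℤ.+<+ ()))
÷-< a (suc b) (mkℚ -[1+ _ ] _ _)     (ℚ.*<* ())
÷-< a (suc b) (mkℚ (ℤ.+ suc p) e _) _ lt = subst (ℚ._< _) (sym ∣x-0∣≡x) (ℚ.toℚᵘ-cancel-<
  -- Since `a ÷ suc b` is stored in lowest terms, the cross-multiplication is done on its
  -- unnormalised representative.
  (ℚᵘ.<-respˡ-≃ (ℚᵘ.≃-sym (ℚ.toℚᵘ-fromℚᵘ (mkℚᵘ (ℤ.+ a) b)))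
    (ℚᵘ.*<* (subst₂ ℤ._<_ (ℤ.pos-* a (suc e)) (ℤ.pos-* (suc p) (suc b))
      (ℤ.+<+ (<-≤-trans lt (m≤m+n (suc b) (p * suc b))))))))
  where
  x = a ÷ suc b
  ∣x-0∣≡x : ℚ.∣ x ℚ.- 0ℚ ∣ ≡ x
  ∣x-0∣≡x = trans (cong ℚ.∣_∣ (ℚ.+-identityʳ x))
    (ℚ.0≤p⇒∣p∣≡p (ℚ.nonNegative⁻¹ x {{ℚ.normalize-nonNeg a (suc b)}}))

proposition1p12 : ∀ (k d ℓ : ℕ) .{{_ : NonZero k}} →
    1 ≤ d → d ≤ k ∸ 1 → ℓ ≤ k ∸ 1 →
    (k ∸ ℓ) ⊔ (⌊ k /2⌋ + 1) ≤ d →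
    g[ k , d , ℓ ]≐ 0ℚ
proposition1p12 k@(suc k-1) d ℓ 1≤d d≤k-1 ℓ≤k-1 max≤d ε 0<ε = N , bound
  where
  -- An edge adds `k ∸ d = suc r` vertices to `S`; `r` of them remain once an escaping one is fixed.
  r = k-1 ∸ d
  k≡d+1+r : k ≡ d + suc r
  k≡d+1+r = trans (cong suc (sym (m+[n∸m]≡n d≤k-1))) (sym (+-suc d r))
  r<ℓ : suc r ≤ ℓ
  r<ℓ = +-cancelˡ-≤ d _ _ (begin
    d + suc r       ≡⟨ k≡d+1+r ⟨
    k               ≤⟨ m≤n+m∸n k ℓ ⟩
    ℓ + (k ∸ ℓ)     ≤⟨ +-monoʳ-≤ ℓ (m⊔n≤o⇒m≤o _ _ max≤d) ⟩
    ℓ + d           ≡⟨ +-comm ℓ d ⟩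
    d + ℓ           ∎)
    where open ≤-Reasoning
  r+1<d : suc r < d
  r+1<d = +-cancelˡ-< d _ _ (begin-strict
    d + suc r                      ≡⟨ k≡d+1+r ⟨
    k                              ≡⟨ ⌊n/2⌋+⌈n/2⌉≡n k ⟨
    -- The ceiling exceeds the floor by at most 1, so k ≤ 2⌊k/2⌋ + 1 < 2d.
    ⌊ k /2⌋ + ⌈ k /2⌉              ≤⟨ +-monoʳ-≤ ⌊ k /2⌋ (⌊n/2⌋-mono (n≤1+n (suc k))) ⟩
    ⌊ k /2⌋ + suc ⌊ k /2⌋          <⟨ ≤-refl ⟩
    suc ⌊ k /2⌋ + suc ⌊ k /2⌋      ≡⟨ cong₂ _+_ (+-comm 1 ⌊ k /2⌋) (+-comm 1 ⌊ k /2⌋) ⟩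
    (⌊ k /2⌋ + 1) + (⌊ k /2⌋ + 1)  ≤⟨ +-mono-≤ ⌊k/2⌋+1≤d ⌊k/2⌋+1≤d ⟩
    d + d                          ∎)
    where
    open ≤-Reasoning
    ⌊k/2⌋+1≤d = m⊔n≤o⇒n≤o (k ∸ ℓ) _ max≤d
  -- `K` is the threshold of the binomial comparison for `c = d * ℚ.↧ₙ ε`, to be met by `n ∸ d`. The
  -- summands of `N` also secure `d + d ≤ n` and `ℓ ≤ n`.
  K = r + suc (suc r * (d * ℚ.↧ₙ ε))
  N = d + d + ℓ + K
  bound : ∀ n → N ≤ n → n ≋ ℓ [mod k ] →
          ℚ.∣ maxδ k ℓ n d ÷ ((n ∸ d) C (k ∸ d)) ℚ.- 0ℚ ∣ ℚ.< ε
  bound n N≤n n≡ℓ = ÷-< _ _ ε 0<ε (begin-strict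
    maxδ k ℓ n d * ℚ.↧ₙ ε          ≤⟨ *-monoˡ-≤ (ℚ.↧ₙ ε) (maxδ≤ k d r ℓ n k≡d+1+r r<ℓ r+1<d 2d≤n
                                       (≋⇒≡+quotient k (s≤s ℓ≤k-1) ℓ≤n n≡ℓ)) ⟩
    d * ((n ∸ d) C r) * ℚ.↧ₙ ε     ≡⟨ solve d ((n ∸ d) C r) (ℚ.↧ₙ ε) ⟩
    d * ℚ.↧ₙ ε * ((n ∸ d) C r)     <⟨ *-nCk<nC[1+k] r (d * ℚ.↧ₙ ε) K≤n∸d ⟩
    (n ∸ d) C suc r               ≡⟨ cong ((n ∸ d) C_) (trans (cong (_∸ d) k≡d+1+r) (m+n∸m≡n d (suc r))) ⟨
    (n ∸ d) C (k ∸ d)             ∎)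
    where
    open ≤-Reasoning
    solve : ∀ x y z → x * y * z ≡ x * z * y
    solve = solve-∀
    2d≤n : d + d ≤ n
    2d≤n = ≤-trans (≤-trans (m≤m+n _ ℓ) (m≤m+n _ K)) N≤n
    ℓ≤n : ℓ ≤ n
    ℓ≤n = ≤-trans (≤-trans (m≤n+m ℓ (d + d)) (m≤m+n _ K)) N≤n
    K≤n∸d : K ≤ n ∸ d
    K≤n∸d = m+n≤o⇒n≤o (d + ℓ) (m+n≤o⇒m≤o∸n _ (≤-trans (≤-reflexive (rearrange d ℓ K)) N≤n))
      where
      rearrange : ∀ d ℓ K → d + ℓ + K + d ≡ d + d + ℓ + K
      rearrange = solve-∀
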